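{- Let $d\in\mathbb{N}$. Every finite union of properties (of graphs of maximum degree at most $d$) defined by $0$-profiles is GSF-local. That is, if $k\in\mathbb{N}$, $r_1,\dots,r_k\in\mathbb{N}$, and $\rho_i$ is a $0$-profile of radius $r_i$ and degree $d$ for graphs for each $1\le i\le k$, then the graph property $\bigcup_{1\le i\le k}\mathcal{P}_{\rho_i}\subseteq\mathcal{C}_d$ is GSF-local.
   Context: Graphs are finite, simple and undirected (possibly empty). For $d\in\mathbb{N}$, $\mathcal{C}_d$ is the class of all graphs of maximum degree at most $d$; all graph properties are isomorphism-closed subsets of $\mathcal{C}_d$. $\mathbb{N}$ includes $0$. Neighbourhood types. For $r\in\mathbb{N}$ and $v\in V(G)$, $N_r^G(v)$ is the set of vertices at distance at most $r$ from $v$ in $G$, and $\mathcal{N}_r^G(v)=G[N_r^G(v)]$ is the induced subgraph. An $r$-ball is a pair $(B,b)$ with $B$ a graph, $b\in V(B)$ and $V(B)=N_r^B(b)$; two $r$-balls are isomorphic if there is a graph isomorphism between them mapping centre to centre. An $r$-type is an isomorphism class of $r$-balls. A vertex $v$ of $G$ has $r$-type $\tau$ if $(\mathcal{N}_r^G(v),v)\in\tau$. Let $n_{d,r}$ be the (finite) number of $r$-types of graphs of degree at most $d$, and fix an enumeration $\tau_{d,r}^1,\dots,\tau_{d,r}^{n_{d,r}}$ of them. The $r$-histogram vector $\overline{v}_{d,r}(G)$ of $G\in\mathcal{C}_d$ has $i$-th entry equal to the number of vertices of $G$ of $r$-type $\tau_{d,r}^i$. $0$-profiles. Let $\mathfrak{I}_0=\{[0,\infty)\}\cup\{[0,k]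 : k\in\mathbb{N}\}$. A $0$-profile of radius $r$ and degree $d$ is a function $\rho:\{1,\dots,n_{d,r}\}\to\mathfrak{I}_0$. The property it defines is $\mathcal{P}_\rho=\{G\in\mathcal{C}_d : (\overline{v}_{d,r}(G))_i\in\rho(i)\text{ for all }1\le i\le n_{d,r}\}$. Generalised subgraph freeness. For a graph $G$, $N_1^G(v)$ is the closed neighbourhood of $v$ ($v$ together with its neighbours). A marked graph is a graph each of whose vertices is marked either `full', `semifull' or `partial'. An embedding of a marked graph $F$ into a graph $G$ is an injective map $f:V(F)\to V(G)$ such that for every $v\in V(F)$: (1) if $v$ is marked `full', then $N_1^G(f(v))=f(N_1^F(v))$; (2) if $v$ is marked `semifull', then $N_1^G(f(v))\cap f(V(F))=f(N_1^F(v))$; (3) if $v$ is marked `partial', then $N_1^G(f(v))\supseteq f(N_1^F(v))$. $G$ is $F$-free if there is no embedding of $F$ into $G$, and $\mathcal{F}$-free, for a set $\mathcal{F}$ of marked graphs, if it is $F$-free for every $F\in\mathcal{F}$. GSF-locality. For a property $\mathcal{P}\subseteq\mathcal{C}_d$ let $\mathcal{P}_n=\{G\in\mathcal{P} : |V(G)|=n\}$. $\mathcal{P}$ is GSF-local if there are a sequence $(\mathcal{F}_n)_{n\in\mathbb{N}}$ of sets of marked graphs and an integer $s$ such that for every $n$ each marked graph in $\mathcal{F}_n$ has size at most $s$, and $\mathcal{P}_n$ equals the set of $n$-vertex graphs (in $\mathcal{C}_d$) that are $\mathcal{F}_n$-free. -}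

module Defs where

open import Data.Bool.Base using (Bool; true; false; T)
open import Data.Bool.Properties using (T?) renaming (_≟_ to _≟ᵇ_)
open import Data.Empty using (⊥-elim)
open import Data.Fin.Base using (Fin; zero; suc)
open import Data.Fin.Permutation using (Permutation; permutation; _⟨$⟩ʳ_; _⟨$⟩ˡ_; inverseˡ; inverseʳ)
open import Data.Fin.Properties using (_≟_; any?; all?; injective⇒≤)
open import Data.List.Base using (List; []; _∷_; [_]; _++_; length; lookup; filter; allFin; upTo; map; concatMap; cartesianProductWith; deduplicate)
open import Data.List.Membership.Propositional using (find; lose) renaming (_∈_ to _∈ₗ_)
open import Data.List.Membership.Propositional.Properties using (∈-allFin; ∈-upTo⁺; ∈-filter⁺; ∈-filter⁻; ∈-lookup; ∈-concatMap⁺; ∈-++⁺ˡ; ∈-++⁺ʳ; ∈-cartesianProductWith⁺)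
open import Data.List.Membership.Setoid.Properties using (index-injective)
open import Data.List.Properties using (length-++; filter-≐)
import Data.List.Relation.Unary.All as All
open import Data.List.Relation.Unary.AllPairs using (_∷_)
import Data.List.Relation.Unary.Any as Any
open import Data.List.Relation.Unary.Any using (Any; here; there)
open import Data.List.Relation.Unary.Any.Properties using (lookup-index)
open import Data.List.Relation.Unary.Enumerates.Setoid using (IsEnumeration)
open import Data.List.Relation.Unary.Enumerates.Setoid.Properties using (deduplicate⁺)
import Data.List.Relation.Unary.Unique.DecSetoid.Properties as UniqueDec
open import Data.List.Relation.Unary.Unique.Propositional.Properties using (allFin⁺; filter⁺)
open import Data.List.Relation.Unary.Unique.Setoid using (Unique)
open import Data.Nat.Base using (ℕ; zero; suc; _≤_; _+_; _*_; _^_; z≤n; s≤s)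
import Data.Nat.Properties as ℕ
open import Data.Product.Base using (Σ; Σ-syntax; ∃; _×_; _,_; proj₁; proj₂)
open import Data.Sum.Base using (_⊎_; inj₁; inj₂)
open import Data.Unit.Base using (⊤)
open import Function.Base using (_∘_; id)
open import Function.Definitions using (Injective)
open import Level using (0ℓ)
open import Relation.Binary.Bundles using (DecSetoid)
import Relation.Binary.Construct.On as On
import Relation.Binary.Definitions as B
open import Relation.Binary.PropositionalEquality using (_≡_; _≗_; refl; sym; trans; cong; cong₂; subst; setoid)
open import Relation.Nullary using (¬_; Dec; yes; no; ¬?; _×-dec_; _⊎-dec_; _→-dec_)
open import Relation.Nullary.Decidable using (map′)
open import Relation.Unary using (Pred; Decidable; _∈_; _∩_; _≐_; _⊇_; U)

record Graph : Set where
  field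
    order       : ℕ
    edge        : Fin order → Fin order → Bool
    edge-sym    : ∀ {u v} → T (edge u v) → T (edge v u)
    edge-irrefl : ∀ {v} → ¬ T (edge v v)

  V : Set
  V = Fin order

  Adj : V → V → Set
  Adj u v = T (edge u v)

  degree : V → ℕ
  degree v = length (filter (T? ∘ edge v) (allFin order))

open Graph public

𝒞 : ℕ → Pred Graph 0ℓ
𝒞 d G = ∀ v → degree G v ≤ d

-- `w ∈ N G r v` says that some walk from v to w has length at most r.
data N (G : Graph) : ℕ → V G → V G → Set where
  stop : ∀ {r v} → N G r v v
  step : ∀ {r v u w} → N G r v u → Adj G u w → N G (suc r) v w

N? : ∀ G r v → Decidable (N G r v)
N? G zero    v w = map′ (λ { refl → stop }) (λ { stop → refl }) (v ≟ w)
N? G (suc r) v w = map′ to from (v ≟ w ⊎-dec any? (λ u → N? G r v u ×-dec T? (edge G u w)))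
  where
  to : v ≡ w ⊎ (∃ λ u → N G r v u × Adj G u w) → N G (suc r) v w
  to (inj₁ refl)        = stop
  to (inj₂ (u , p , e)) = step p e
  from : N G (suc r) v w → v ≡ w ⊎ (∃ λ u → N G r v u × Adj G u w)
  from stop       = inj₁ refl
  from (step p e) = inj₂ (_ , p , e)

-- Vertex i of the induced subgraph stands for the i-th vertex of G
-- satisfying P.
induced : (G : Graph) {P : Pred (V G) 0ℓ} → Decidable P → Graph
induced G P? = record
  { order       = length vs
  ; edge        = λ i j → edge G (lookup vs i) (lookup vs j)
  ; edge-sym    = edge-sym G
  ; edge-irrefl = edge-irrefl G
  }
  where vs = filter P? (allFin (order G))

record Ball (r : ℕ) : Set where
  field
    graph  : Graph
    centre : V graph
    covers : ∀ v → v ∈ N graph r centre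

open Ball public

N-weaken : ∀ {G r s v w} → r ≤ s → N G r v w → N G s v w
N-weaken _         stop       = stop
N-weaken (s≤s r≤s) (step p e) = step (N-weaken r≤s p) e

lookup-injective : ∀ {A : Set} {xs : List A} → Unique (setoid A) xs →
                   ∀ i j → lookup xs i ≡ lookup xs j → i ≡ j
lookup-injective (_  ∷ _)  zero    zero    _  = refl
lookup-injective (px ∷ _)  zero    (suc j) eq = ⊥-elim (All.lookup px (∈-lookup j) eq)
lookup-injective (px ∷ _)  (suc i) zero    eq = ⊥-elim (All.lookup px (∈-lookup i) (sym eq))
lookup-injective (_  ∷ ps) (suc i) (suc j) eq = cong suc (lookup-injective ps i j eq)

𝒩 : (r : ℕ) (G : Graph) → V G → Ball r
𝒩 r G v = record
  { graph  = H
  ; centre = c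
  ; covers = λ i → lift ℕ.≤-refl (proj₂ (∈-filter⁻ (N? G r v) {xs = allFin (order G)} (∈-lookup {xs = vs} i))) i refl
  }
  where
  H = induced G (N? G r v)
  vs = filter (N? G r v) (allFin (order G))

  position : ∀ {w} → w ∈ N G r v → w ∈ₗ vs
  position {w} = ∈-filter⁺ (N? G r v) (∈-allFin w)

  c : V H
  c = Any.index (position stop)

  lookup-inj : ∀ i j → lookup vs i ≡ lookup vs j → i ≡ j
  lookup-inj i j = lookup-injective (filter⁺ (N? G r v) (allFin⁺ (order G))) i j

  lift : ∀ {s w} → s ≤ r → N G s v w → ∀ i → lookup vs i ≡ w → N H s c i
  lift _ stop i eq
    with refl ← lookup-inj c i (trans (sym (lookup-index (position stop))) (sym eq)) = stop
  lift s<r (step {u = u} p e) i refl = step (lift s≤r p j (sym u≡)) (subst (λ x → T (edge G x (lookup vs i))) u≡ e)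
    where
    s≤r = ℕ.≤-trans (ℕ.n≤1+n _) s<r
    u∈  = position (N-weaken s≤r p)
    j   = Any.index u∈
    u≡  = lookup-index u∈

infix 4 _≅_ _≅?_

record _≅_ {r : ℕ} (B C : Ball r) : Set where
  field
    bij         : Permutation (order (graph B)) (order (graph C))
    edge-pres   : ∀ u v → edge (graph B) u v ≡ edge (graph C) (bij ⟨$⟩ʳ u) (bij ⟨$⟩ʳ v)
    centre-pres : bij ⟨$⟩ʳ centre B ≡ centre C

open _≅_ public

≅-refl : ∀ {r} → B.Reflexive (_≅_ {r})
≅-refl = record
  { bij         = permutation id id (λ _ → refl) (λ _ → refl)
  ; edge-pres   = λ _ _ → refl
  ; centre-pres = refl
  }

≅-sym : ∀ {r} → B.Symmetric (_≅_ {r})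
≅-sym {x = B} {C} I = record
  { bij         = permutation (bij I ⟨$⟩ˡ_) (bij I ⟨$⟩ʳ_) (λ _ → inverseˡ (bij I)) (λ _ → inverseʳ (bij I))
  ; edge-pres   = λ u v → sym (trans (edge-pres I _ _) (cong₂ (edge (graph C)) (inverseʳ (bij I)) (inverseʳ (bij I))))
  ; centre-pres = trans (cong (bij I ⟨$⟩ˡ_) (sym (centre-pres I))) (inverseˡ (bij I))
  }

≅-trans : ∀ {r} → B.Transitive (_≅_ {r})
≅-trans I J = record
  { bij         = permutation (λ u → bij J ⟨$⟩ʳ (bij I ⟨$⟩ʳ u)) (λ u → bij I ⟨$⟩ˡ (bij J ⟨$⟩ˡ u))
                    (λ _ → trans (cong (bij J ⟨$⟩ʳ_) (inverseʳ (bij I))) (inverseʳ (bij J)))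
                    (λ _ → trans (cong (bij I ⟨$⟩ˡ_) (inverseˡ (bij J))) (inverseˡ (bij I)))
  ; edge-pres   = λ u v → trans (edge-pres I u v) (edge-pres J _ _)
  ; centre-pres = trans (cong (bij J ⟨$⟩ʳ_) (centre-pres I)) (centre-pres J)
  }

-- Without function extensionality a finite function space can be listed
-- only up to pointwise equality.
functions : ∀ {A : Set} → List A → ∀ n → List (Fin n → A)
functions xs zero    = [ (λ ()) ]
functions xs (suc n) = cartesianProductWith (λ x f → λ { zero → x ; (suc i) → f i }) xs (functions xs n)

functions-complete : ∀ {A : Set} {xs : List A} n (f : Fin n → A) → (∀ i → f i ∈ₗ xs) →
                     Σ[ g ∈ (Fin n → A) ] g ∈ₗ functions xs n × g ≗ f
functions-complete zero    f f∈ = _ , here refl , λ ()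
functions-complete (suc n) f f∈ =
  let g , g∈ , g≗ = functions-complete n (f ∘ suc) (f∈ ∘ suc) in
  _ , ∈-cartesianProductWith⁺ _ (f∈ zero) g∈ , λ { zero → refl ; (suc i) → g≗ i }

_≅?_ : ∀ {r} → B.Decidable (_≅_ {r})
_≅?_ B C = map′ to from
  (Any.any? (λ f → Any.any? (valid? f) (functions (allFin m) n)) (functions (allFin n) m))
  where
  m = order (graph B)
  n = order (graph C)

  Valid : (Fin m → Fin n) → (Fin n → Fin m) → Set
  Valid f g = (∀ j → f (g j) ≡ j) × (∀ i → g (f i) ≡ i)
            × (∀ u v → edge (graph B) u v ≡ edge (graph C) (f u) (f v))
            × f (centre B) ≡ centre C

  valid? : ∀ f g → Dec (Valid f g)
  valid? f g = all? (λ j → f (g j) ≟ j) ×-dec all? (λ i → g (f i) ≟ i)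
         ×-dec all? (λ u → all? (λ v → edge (graph B) u v ≟ᵇ edge (graph C) (f u) (f v)))
         ×-dec f (centre B) ≟ centre C

  Found : Set
  Found = Any (λ f → Any (Valid f) (functions (allFin m) n)) (functions (allFin n) m)

  to : Found → B ≅ C
  to p = let f , _ , q = find p
             g , _ , fg , gf , e , c = find q
         in record { bij = permutation f g fg gf ; edge-pres = e ; centre-pres = c }

  from : B ≅ C → Found
  from I =
    let f , f∈ , f≗ = functions-complete m (bij I ⟨$⟩ʳ_) (λ _ → ∈-allFin _)
        g , g∈ , g≗ = functions-complete n (bij I ⟨$⟩ˡ_) (λ _ → ∈-allFin _)
    in lose f∈ (lose g∈
      ( (λ j → trans (f≗ (g j)) (trans (cong (bij I ⟨$⟩ʳ_) (g≗ j)) (inverseʳ (bij I))))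
      , (λ i → trans (g≗ (f i)) (trans (cong (bij I ⟨$⟩ˡ_) (f≗ i)) (inverseˡ (bij I))))
      , (λ u v → trans (edge-pres I u v) (cong₂ (edge (graph C)) (sym (f≗ u)) (sym (f≗ v))))
      , trans (f≗ _) (centre-pres I)
      ))

ballDecSetoid : ℕ → DecSetoid 0ℓ 0ℓ
ballDecSetoid r = record
  { Carrier          = Ball r
  ; _≈_              = _≅_
  ; isDecEquivalence = record
    { isEquivalence = record { refl = ≅-refl ; sym = ≅-sym ; trans = ≅-trans }
    ; _≟_           = _≅?_
    }
  }

BoundedBall : ℕ → ℕ → Set
BoundedBall d r = Σ[ B ∈ Ball r ] graph B ∈ 𝒞 d

-- The equivalence classes of this setoid are the r-types of graphs of
-- degree at most d.
types : ℕ → ℕ → DecSetoid 0ℓ 0ℓ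
types d r = On.decSetoid {B = BoundedBall d r} (ballDecSetoid r) proj₁

-- An enumeration of the r-types, given by one representative of each.
-- One exists for all d and r: see `typeEnumeration` below.
record TypeEnumeration (d r : ℕ) : Set where
  open DecSetoid (types d r) using () renaming (setoid to typeSetoid)
  field
    representatives : List (BoundedBall d r)
    complete        : IsEnumeration typeSetoid representatives
    distinct        : Unique typeSetoid representatives

  #types : ℕ
  #types = length representatives

  type : Fin #types → Ball r
  type i = proj₁ (lookup representatives i)

open TypeEnumeration public

module _ {d r : ℕ} (τ : TypeEnumeration d r) where

  histogram : Graph → Fin (#types τ) → ℕ
  histogram G i = length (filter (λ v → 𝒩 r G v ≅? type τ i) (allFin (order G)))

-- [0,∞[ is the interval [0,∞): names cannot contain parentheses.
data 𝔍₀ : Set where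
  [0,∞[ : 𝔍₀
  [0,_] : ℕ → 𝔍₀

⟦_⟧ : 𝔍₀ → Pred ℕ 0ℓ
⟦ [0,∞[   ⟧ _ = ⊤
⟦ [0, k ] ⟧ n = n ≤ k

ZeroProfile : ∀ {d r} → TypeEnumeration d r → Set
ZeroProfile τ = Fin (#types τ) → 𝔍₀

𝒫 : ∀ {d r} (τ : TypeEnumeration d r) → ZeroProfile τ → Pred Graph 0ℓ
𝒫 {d} τ ρ G = G ∈ 𝒞 d × (∀ i → histogram τ G i ∈ ⟦ ρ i ⟧)

data Mark : Set where
  full semifull partial : Mark

record MarkedGraph : Set where
  field
    underlying : Graph
    mark       : V underlying → Mark

open MarkedGraph public

image : {A B : Set} → (A → B) → Pred A 0ℓ → Pred B 0ℓ
image f P b = ∃ λ a → a ∈ P × f a ≡ b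

module _ (F : MarkedGraph) (G : Graph) (f : V (underlying F) → V G) where

  Respects : V (underlying F) → Mark → Set
  Respects v full     = N G 1 (f v) ≐ image f (N (underlying F) 1 v)
  Respects v semifull = N G 1 (f v) ∩ image f U ≐ image f (N (underlying F) 1 v)
  Respects v partial  = N G 1 (f v) ⊇ image f (N (underlying F) 1 v)

  IsEmbedding : Set
  IsEmbedding = Injective _≡_ _≡_ f × (∀ v → Respects v (mark F v))

Free : Pred MarkedGraph 0ℓ → Pred Graph 0ℓ
Free 𝓕 G = ∀ F → F ∈ 𝓕 → ¬ ∃ (IsEmbedding F G)

HasOrder : ℕ → Pred Graph 0ℓ
HasOrder n G = order G ≡ n

GSFLocal : ℕ → Pred Graph 0ℓ → Set₁
GSFLocal d P =
  Σ[ 𝓕 ∈ (ℕ → Pred MarkedGraph 0ℓ) ] Σ[ s ∈ ℕ ] ∀ n →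
    (∀ F → F ∈ 𝓕 n → order (underlying F) ≤ s) ×
    (P ∩ HasOrder n) ≐ (𝒞 d ∩ HasOrder n ∩ Free (𝓕 n))

-- The rest of the file shows that type enumerations exist, so that
-- quantifying over them is not vacuous. An r-ball of degree at most d has
-- at most (1 + d) ^ r vertices, so up to isomorphism all of them occur
-- among the balls on Fin n for n in that range.

module Bound {d : ℕ} (G : Graph) (G∈𝒞 : G ∈ 𝒞 d) (v : V G) where

  neighbours : V G → List (V G)
  neighbours u = filter (T? ∘ edge G u) (allFin (order G))

  reach : ℕ → List (V G)
  reach zero    = [ v ]
  reach (suc r) = reach r ++ concatMap neighbours (reach r)

  reach-complete : ∀ {r w} → N G r v w → w ∈ₗ reach r
  reach-complete {zero}  stop = here refl
  reach-complete {suc r} stop = ∈-++⁺ˡ (reach-complete {r} stop)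
  reach-complete {suc r} (step {u = u} {w} p e) =
    ∈-++⁺ʳ (reach r) (∈-concatMap⁺ neighbours
      (Any.map (λ { refl → ∈-filter⁺ (T? ∘ edge G u) (∈-allFin w) e }) (reach-complete p)))

  length-neighbours : ∀ us → length (concatMap neighbours us) ≤ length us * d
  length-neighbours []       = z≤n
  length-neighbours (u ∷ us) = ℕ.≤-trans
    (ℕ.≤-reflexive (length-++ (neighbours u)))
    (ℕ.+-mono-≤ (G∈𝒞 u) (length-neighbours us))

  length-reach : ∀ r → length (reach r) ≤ suc d ^ r
  length-reach zero    = ℕ.≤-refl
  length-reach (suc r) = begin
    length (reach r ++ concatMap neighbours (reach r))
      ≡⟨ length-++ (reach r) ⟩
    length (reach r) + length (concatMap neighbours (reach r))
      ≤⟨ ℕ.+-monoʳ-≤ (length (reach r)) (length-neighbours (reach r)) ⟩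
    length (reach r) + length (reach r) * d
      ≡⟨ ℕ.*-suc (length (reach r)) d ⟨
    length (reach r) * suc d
      ≡⟨ ℕ.*-comm (length (reach r)) (suc d) ⟩
    suc d * length (reach r)
      ≤⟨ ℕ.*-monoʳ-≤ (suc d) (length-reach r) ⟩
    suc d ^ suc r ∎
    where open ℕ.≤-Reasoning

  order≤ : ∀ {r} → (∀ w → w ∈ N G r v) → order G ≤ suc d ^ r
  order≤ {r} cov = ℕ.≤-trans
    (injective⇒≤ (λ {x} {y} → index-injective (setoid (V G)) (reach-complete (cov x)) (reach-complete (cov y))))
    (length-reach r)

witness : {A : Set} → Dec A → List A
witness (yes a) = [ a ]
witness (no _)  = []

Simple : ∀ {n} → (Fin n → Fin n → Bool) → Set
Simple e = (∀ u v → T (e u v) → T (e v u)) × (∀ v → ¬ T (e v v))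

simple? : ∀ {n} (e : Fin n → Fin n → Bool) → Dec (Simple e)
simple? e = all? (λ u → all? (λ v → T? (e u v) →-dec T? (e v u))) ×-dec all? (λ v → ¬? (T? (e v v)))

toGraph : ∀ {n} (e : Fin n → Fin n → Bool) → Simple e → Graph
toGraph {n} e (s , i) = record { order = n ; edge = e ; edge-sym = λ {u} {v} → s u v ; edge-irrefl = λ {v} → i v }

relations : ∀ n → List (Fin n → Fin n → Bool)
relations n = functions (functions (true ∷ false ∷ []) n) n

bool∈ : ∀ b → b ∈ₗ (true ∷ false ∷ [])
bool∈ true  = here refl
bool∈ false = there (here refl)

relations-complete : ∀ n (e : Fin n → Fin n → Bool) →
                     ∃ λ e′ → e′ ∈ₗ relations n × (∀ u v → e′ u v ≡ e u v)
relations-complete n e =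
  let row    = λ u → functions-complete n (e u) (λ v → bool∈ (e u v))
      e′ , e′∈ , e′≗ = functions-complete n (proj₁ ∘ row) (proj₁ ∘ proj₂ ∘ row)
  in e′ , e′∈ , λ u v → trans (cong (λ f → f v) (e′≗ u)) (proj₂ (proj₂ (row u)) v)

graphs : ℕ → List Graph
graphs n = concatMap (λ e → map (toGraph e) (witness (simple? e))) (relations n)

∈-witness : ∀ {A B : Set} (f : A → B) (Q : Pred B 0ℓ) (A? : Dec A) → A → (∀ a → Q (f a)) →
            ∃ λ b → b ∈ₗ map f (witness A?) × Q b
∈-witness f Q (yes a) _ q = f a , here refl , q a
∈-witness f Q (no ¬a) a _ = ⊥-elim (¬a a)

∈-concatMap : ∀ {A B : Set} (f : A → List B) {x y xs} → x ∈ₗ xs → y ∈ₗ f x → y ∈ₗ concatMap f xs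
∈-concatMap f x∈ y∈ = ∈-concatMap⁺ f (lose x∈ y∈)

SameEdges : (G : Graph) → (V G → V G → Bool) → Set
SameEdges G e = ∀ u v → e u v ≡ edge G u v

graphs-complete : ∀ G → ∃ λ e → SameEdges G e × Σ[ p ∈ Simple e ] toGraph e p ∈ₗ graphs (order G)
graphs-complete G =
  let e , e∈ , e≡ = relations-complete (order G) (edge G)
      H , H∈ , p , H≡ = ∈-witness (toGraph e) (λ H → Σ[ p ∈ Simple e ] H ≡ toGraph e p) (simple? e)
        ( (λ u v a → subst T (sym (e≡ v u)) (edge-sym G (subst T (e≡ u v) a)))
        , (λ v a → edge-irrefl G (subst T (e≡ v v) a)))
        (λ p → p , refl)
  in e , e≡ , p , subst (_∈ₗ graphs (order G)) H≡ (∈-concatMap (λ e → map (toGraph e) (witness (simple? e))) e∈ H∈)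

N-pres : ∀ G {e} (p : Simple e) → SameEdges G e → ∀ {r v w} → N G r v w → N (toGraph e p) r v w
N-pres G p eq stop       = stop
N-pres G p eq (step q a) = step (N-pres G p eq q) (subst T (sym (eq _ _)) a)

module Candidates (d r : ℕ) where

  IsBoundedBall : (G : Graph) → V G → Set
  IsBoundedBall G b = (∀ v → v ∈ N G r b) × G ∈ 𝒞 d

  isBoundedBall? : ∀ G b → Dec (IsBoundedBall G b)
  isBoundedBall? G b = all? (N? G r b) ×-dec all? (λ v → degree G v ℕ.≤? d)

  toBall : ∀ G b → IsBoundedBall G b → BoundedBall d r
  toBall G b (cov , deg) = record { graph = G ; centre = b ; covers = cov } , deg

  balls : Graph → List (BoundedBall d r)
  balls G = concatMap (λ b → map (toBall G b) (witness (isBoundedBall? G b))) (allFin (order G))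

  candidates : List (BoundedBall d r)
  candidates = concatMap balls (concatMap graphs (upTo (suc (suc d ^ r))))

  balls-complete : (B : BoundedBall d r) → let G = graph (proj₁ B) in
                   ∀ {e} (p : Simple e) → SameEdges G e →
                   ∃ λ C → C ∈ₗ balls (toGraph e p) × proj₁ B ≅ proj₁ C
  balls-complete (B , deg) {e} p eq =
    let G = graph B
        H = toGraph e p
        b = centre B
        C , C∈ , I = ∈-witness (toBall H b) (λ C → B ≅ proj₁ C) (isBoundedBall? H b)
          ( (λ v → N-pres G p eq (covers B v))
          , (λ v → ℕ.≤-trans (ℕ.≤-reflexive (cong length
              (filter-≐ (T? ∘ e v) (T? ∘ edge G v)
                ((λ {u} → subst T (eq v u)) , (λ {u} → subst T (sym (eq v u)))) (allFin _)))) (deg v)))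
          (λ _ → record
            { bij         = permutation id id (λ _ → refl) (λ _ → refl)
            ; edge-pres   = λ u v → sym (eq u v)
            ; centre-pres = refl })
    in C , ∈-concatMap (λ b → map (toBall H b) (witness (isBoundedBall? H b))) (∈-allFin b) C∈ , I

  candidates-complete : IsEnumeration (DecSetoid.setoid (types d r)) candidates
  candidates-complete B@(B₀ , deg) =
    let G = graph B₀
        e , e≡ , p , H∈ = graphs-complete G
        C , C∈ , I = balls-complete B p e≡
        G≤ = Bound.order≤ G deg (centre B₀) (covers B₀)
    in Any.map (λ { refl → I })
         (∈-concatMap balls (∈-concatMap graphs (∈-upTo⁺ (s≤s G≤)) H∈) C∈)

typeEnumeration : ∀ d r → TypeEnumeration d r
typeEnumeration d r = record
  { representatives = deduplicate (DecSetoid._≟_ (types d r)) candidates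
  ; complete        = deduplicate⁺ (types d r) candidates-complete
  ; distinct        = UniqueDec.deduplicate-! (types d r) candidates
  }
  where open Candidates d r

{-# OPTIONS --safe #-}

-- Take for 𝓕 all marked graphs of size at most s that embed into no graph of
-- the property; only completeness of 𝓕 is then in question. A graph G of
-- degree at most d outside the union violates, for every i, some bound
-- [0,κ] of ρ i, so G has κ + 1 vertices of the corresponding type. Let F be
-- the subgraph of G induced by the rᵢ-balls around these vertices for all i,
-- where a vertex is full if its G-neighbours all lie in F and semifull
-- otherwise. An embedding of F into H is then induced and preserves the types
-- of the chosen vertices, so H violates the same bounds as G.
module Submission where

open import Defs
open import Data.Bool.Properties using (T?)
open import Data.Fin.Base using (Fin; inject≤)
open import Data.Fin.Permutation using (permutation)
open import Data.Fin.Properties using (all?; any?; ¬∀⟶∃¬; inject≤-injective; injective⇒≤; _≟_)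
open import Data.List.Base using (List; []; _∷_; length; lookup; filter; allFin; tabulate; concatMap)
open import Data.List.Extrema.Nat using (max; xs≤max)
open import Data.List.Membership.DecPropositional using () renaming (_∈?_ to decMember)
open import Data.List.Membership.Propositional using () renaming (_∈_ to _∈ₗ_)
open import Data.List.Membership.Propositional.Properties using (∈-allFin; ∈-filter⁺; ∈-filter⁻; ∈-lookup; ∈-tabulate⁺)
open import Data.List.Membership.Setoid.Properties using (index-injective)
open import Data.List.Properties using (length-++; length-tabulate)
import Data.List.Relation.Unary.All as All
import Data.List.Relation.Unary.Any as Any
open import Data.List.Relation.Unary.Any.Properties using (lookup-index)
open import Data.List.Relation.Unary.Unique.Propositional.Properties using (allFin⁺; filter⁺)
open import Data.Nat.Base using (ℕ; suc; _≤_; _<_; _*_; _^_; z≤n; s≤s)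
import Data.Nat.Properties as ℕ
open import Data.Product.Base using (∃; _×_; _,_; proj₁; proj₂)
open import Data.Unit.Base using (tt)
open import Function.Base using (_∘_)
open import Function.Bundles using (mk⇔)
open import Function.Definitions using (Injective)
open import Level using (0ℓ)
open import Relation.Binary.PropositionalEquality using (_≡_; _≢_; refl; sym; trans; cong; cong₂; subst; setoid)
open import Relation.Nullary using (Dec; yes; no; contradiction; _×-dec_; _→-dec_)
open import Relation.Nullary.Decidable using (decidable-stable; does-⇔)
open import Relation.Unary using (Pred; Decidable; _∈_; _∉_; ⋃)

-- Positions and counts in filtered vertex lists.

module Filtered {n} {P : Pred (Fin n) 0ℓ} (P? : Decidable P) where

  elements : List (Fin n)
  elements = filter P? (allFin n)

  satisfies : ∀ i → P (lookup elements i)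
  satisfies i = proj₂ (∈-filter⁻ P? {xs = allFin n} (∈-lookup {xs = elements} i))

  position : ∀ {w} → P w → Fin (length elements)
  position {w} = Any.index ∘ ∈-filter⁺ P? (∈-allFin w)

  lookup-position : ∀ {w} (p : P w) → lookup elements (position p) ≡ w
  lookup-position {w} = sym ∘ lookup-index ∘ ∈-filter⁺ P? (∈-allFin w)

  injective : Injective _≡_ _≡_ (lookup elements)
  injective = lookup-injective (filter⁺ P? (allFin⁺ n)) _ _

  injective⇒≤count : ∀ {m} (g : Fin m → Fin n) → Injective _≡_ _≡_ g → (∀ a → P (g a)) →
                     m ≤ length elements
  injective⇒≤count g g-inj p = injective⇒≤ λ {a} {b} eq → g-inj
    (trans (sym (lookup-position (p a))) (trans (cong (lookup elements) eq) (lookup-position (p b))))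

  -- `xs` may contain repetitions: the members of `elements` are distinct, so their positions in
  -- `xs` are distinct too.
  count≤length : ∀ {xs} → (∀ {w} → P w → w ∈ₗ xs) → length elements ≤ length xs
  count≤length P⊆xs = injective⇒≤ λ {i} {j} →
    injective ∘ index-injective (setoid (Fin n)) (P⊆xs (satisfies i)) (P⊆xs (satisfies j))

open Filtered using (elements; satisfies; position; lookup-position)

≤-supremum : ∀ {n} (f : Fin n → ℕ) → ∃ λ b → ∀ i → f i ≤ b
≤-supremum f = max 0 (tabulate f) , λ i → All.lookup (xs≤max 0 (tabulate f)) (∈-tabulate⁺ i)

length-concatMap≤ : ∀ {A B : Set} (f : A → List B) {m} → (∀ x → length (f x) ≤ m) →
                    ∀ xs → length (concatMap f xs) ≤ length xs * m
length-concatMap≤ f f≤ []       = z≤n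
length-concatMap≤ f f≤ (x ∷ xs) =
  ℕ.≤-trans (ℕ.≤-reflexive (length-++ (f x))) (ℕ.+-mono-≤ (f≤ x) (length-concatMap≤ f f≤ xs))

module _ {G : Graph} where

  adjacent⇒N₁ : ∀ {u v} → Adj G u v → N G 1 u v
  adjacent⇒N₁ = step stop

  N₁⇒adjacent : ∀ {u v} → u ≢ v → N G 1 u v → Adj G u v
  N₁⇒adjacent u≢v stop          = contradiction refl u≢v
  N₁⇒adjacent _   (step stop e) = e

  adjacent⇒≢ : ∀ {u v} → Adj G u v → u ≢ v
  adjacent⇒≢ e refl = edge-irrefl G e

-- Embeddings without partial vertices, and the balls they preserve.

module Embedded (M : MarkedGraph) (¬partial : ∀ v → mark M v ≢ partial)
                (H : Graph) (f : V (underlying M) → V H) (emb : IsEmbedding M H f) where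

  private F = underlying M

  f-injective : Injective _≡_ _≡_ f
  f-injective = proj₁ emb

  N₁-preserved : ∀ {v w} → N F 1 v w → N H 1 (f v) (f w)
  N₁-preserved {v} {w} p with mark M v | proj₂ emb v
  ... | full     | _ , ⊇ = ⊇ (w , p , refl)
  ... | semifull | _ , ⊇ = proj₁ (⊇ (w , p , refl))
  ... | partial  | ⊇     = ⊇ (w , p , refl)

  -- Since `f w` lies in the image, a semifull mark constrains it just as a full one does.
  N₁-reflected : ∀ {v w} → N H 1 (f v) (f w) → N F 1 v w
  N₁-reflected {v} {w} p with mark M v | ¬partial v | proj₂ emb v
  ... | full     | _  | ⊆ , _ = let u , q , fu≡fw = ⊆ p in subst (N F 1 v) (f-injective fu≡fw) q
  ... | semifull | _  | ⊆ , _ = let u , q , fu≡fw = ⊆ (p , w , tt , refl) in subst (N F 1 v) (f-injective fu≡fw) q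
  ... | partial  | ¬p | _     = contradiction refl ¬p

  N₁-lifted : ∀ {v} → mark M v ≡ full → ∀ {w} → N H 1 (f v) w → w ∈ image f (N F 1 v)
  N₁-lifted {v} v-full p with mark M v | v-full | proj₂ emb v
  ... | full | refl | ⊆ , _ = ⊆ p

  adjacent-preserved : ∀ {u v} → Adj F u v → Adj H (f u) (f v)
  adjacent-preserved e = N₁⇒adjacent {H} (adjacent⇒≢ {F} e ∘ f-injective) (N₁-preserved (adjacent⇒N₁ {F} e))

  adjacent-reflected : ∀ {u v} → Adj H (f u) (f v) → Adj F u v
  adjacent-reflected e = N₁⇒adjacent {F} (adjacent⇒≢ {H} e ∘ cong f) (N₁-reflected (adjacent⇒N₁ {H} e))

  edge-preserved : ∀ u v → edge F u v ≡ edge H (f u) (f v)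
  -- `does (T? b)` reduces to `b`, so the equivalence of adjacencies becomes an equality of
  -- Booleans.
  edge-preserved u v = does-⇔ (mk⇔ adjacent-preserved adjacent-reflected) (T? (edge F u v)) (T? (edge H (f u) (f v)))

  N-preserved : ∀ {r v w} → N F r v w → N H r (f v) (f w)
  N-preserved stop       = stop
  N-preserved (step p e) = step (N-preserved p) (adjacent-preserved e)

  -- The inequality is strict: vertices at distance exactly `r` may be semifull, as a walk of length
  -- at most `r` from `x` never continues beyond them.
  FullInterior : ℕ → V F → Set
  FullInterior r x = ∀ {s w} → s < r → N F s x w → mark M w ≡ full

  -- Induction along the walk: its penultimate vertex lifts to one fewer than `r` steps from `x`,
  -- which is full, so the last step cannot leave the image.
  N-lifted : ∀ {r x} → FullInterior r x → ∀ {s u} → s ≤ r → N H s (f x) u → ∃ λ w → N F s x w × f w ≡ u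
  N-lifted int s≤r stop       = _ , stop , refl
  N-lifted int s<r (step p e)
    with w , q , refl ← N-lifted int (ℕ.<⇒≤ s<r) p
    with w′ , _ , refl ← N₁-lifted (int s<r q) (adjacent⇒N₁ {H} e)
    = w′ , step q (adjacent-reflected e) , refl

  -- `f` restricts to a bijection of the balls: `N-preserved` keeps it inside, `N-lifted` makes it
  -- onto.
  ball-≅ : ∀ {r x} → FullInterior r x → 𝒩 r F x ≅ 𝒩 r H (f x)
  ball-≅ {r} {x} int = record
    { bij         = permutation to from
        (λ j → injH (trans (f∘to (from j)) (f∘from j)))
        (λ i → injF (f-injective (trans (f∘from (to i)) (f∘to i))))
    ; edge-pres   = λ i j → trans (edge-preserved _ _) (cong₂ (edge H) (sym (f∘to i)) (sym (f∘to j)))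
    ; centre-pres = injH (trans (f∘to (centre (𝒩 r F x)))
        (trans (cong f (lookup-position F? stop)) (sym (lookup-position H? stop))))
    }
    where
    F? = N? F r x
    H? = N? H r (f x)

    injF : Injective _≡_ _≡_ (lookup (elements F?))
    injF = Filtered.injective F?

    injH : Injective _≡_ _≡_ (lookup (elements H?))
    injH = Filtered.injective H?

    to : V (graph (𝒩 r F x)) → V (graph (𝒩 r H (f x)))
    to i = position H? (N-preserved (satisfies F? i))

    f∘to : ∀ i → lookup (elements H?) (to i) ≡ f (lookup (elements F?) i)
    f∘to i = lookup-position H? (N-preserved (satisfies F? i))

    preimage : ∀ j → ∃ λ w → N F r x w × f w ≡ lookup (elements H?) j
    preimage j = N-lifted int ℕ.≤-refl (satisfies H? j)

    from : V (graph (𝒩 r H (f x))) → V (graph (𝒩 r F x))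
    from j = position F? (proj₁ (proj₂ (preimage j)))

    f∘from : ∀ j → f (lookup (elements F?) (from j)) ≡ lookup (elements H?) j
    f∘from j = trans (cong f (lookup-position F? (proj₁ (proj₂ (preimage j))))) (proj₂ (proj₂ (preimage j)))

-- The marked subgraph induced by a list of vertices.

module Excerpt (G : Graph) (S : List (V G)) where

  ∈S? : Decidable (_∈ₗ S)
  ∈S? w = decMember _≟_ w S

  ι : Fin (length (elements ∈S?)) → V G
  ι = lookup (elements ∈S?)

  ι-injective : Injective _≡_ _≡_ ι
  ι-injective = Filtered.injective ∈S?

  Inner : V G → Set
  Inner v = ∀ w → N G 1 v w → w ∈ₗ S

  inner? : Decidable Inner
  inner? v = all? λ w → N? G 1 v w →-dec ∈S? w

  fullIf : ∀ {P : Set} → Dec P → Mark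
  fullIf (yes _) = full
  fullIf (no _)  = semifull

  excerpt : MarkedGraph
  excerpt = record { underlying = induced G ∈S? ; mark = fullIf ∘ inner? ∘ ι }

  order≤ : order (underlying excerpt) ≤ length S
  order≤ = Filtered.count≤length ∈S? λ w∈S → w∈S

  ¬partial : ∀ v → mark excerpt v ≢ partial
  ¬partial v eq with inner? (ι v)
  ¬partial v () | yes _
  ¬partial v () | no _

  inner⇒full : ∀ v → Inner (ι v) → mark excerpt v ≡ full
  inner⇒full v p with inner? (ι v)
  ... | yes _ = refl
  ... | no ¬p = contradiction p ¬p

  private F = underlying excerpt

  N⇒N : ∀ {r v w} → N F r v w → N G r (ι v) (ι w)
  N⇒N stop       = stop
  N⇒N (step p e) = step (N⇒N p) e

  N₁⇐N₁ : ∀ {v w} → N G 1 (ι v) (ι w) → N F 1 v w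
  N₁⇐N₁ {v} {w} p with v ≟ w
  ... | yes refl = stop
  ... | no v≢w   = step stop (N₁⇒adjacent {G} (v≢w ∘ ι-injective) p)

  -- Serves twice: it shows that `G` contains its own excerpt, and it lets `ball-≅` compare balls of
  -- the excerpt with balls of `G`.
  ι-isEmbedding : IsEmbedding excerpt G ι
  ι-isEmbedding = ι-injective , respects
    where
    respects : ∀ v → Respects excerpt G ι v (mark excerpt v)
    respects v with inner? (ι v)
    ... | yes inner =
          (λ {w} p → let ι≡w = lookup-position ∈S? (inner w p)
                     in _ , N₁⇐N₁ (subst (N G 1 (ι v)) (sym ι≡w) p) , ι≡w)
        , λ { (_ , p , refl) → N⇒N p }
    ... | no _ =
          (λ { (p , j , _ , refl) → j , N₁⇐N₁ p , refl })
        , λ { (j , p , refl) → N⇒N p , j , tt , refl }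

  module _ (H : Graph) (f : V F → V H) (emb : IsEmbedding excerpt H f) where

    type-preserved : ∀ {r} x → (∀ {w} → N G r (ι x) w → w ∈ₗ S) → 𝒩 r G (ι x) ≅ 𝒩 r H (f x)
    type-preserved {r} x ball⊆S = ≅-trans
      (≅-sym (Embedded.ball-≅ excerpt ¬partial G ι ι-isEmbedding interior))
      (Embedded.ball-≅ excerpt ¬partial H f emb interior)
      where
      -- A neighbour of a vertex at distance `s < r` is still in the `r`-ball, hence in `S`.
      -- `FullInterior` depends on the excerpt alone, so this proof serves both for `ι` and for `f`.
      interior : Embedded.FullInterior excerpt ¬partial G ι ι-isEmbedding r x
      interior s<r p = inner⇒full _ λ where
        _ stop          → ball⊆S (N-weaken (ℕ.<⇒≤ s<r) (N⇒N p))
        _ (step stop e) → ball⊆S (N-weaken s<r (step (N⇒N p) e))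

-- Violated bounds and the vertices that witness them.

-- [0,∞[ gets the junk value 0: only bounds that can be violated matter.
bound : 𝔍₀ → ℕ
bound [0,∞[   = 0
bound [0, k ] = k

∉⇒bound< : ∀ I {n} → n ∉ ⟦ I ⟧ → bound I < n
∉⇒bound< [0,∞[   n∉ = contradiction tt n∉
∉⇒bound< [0, k ] n∉ = ℕ.≰⇒> n∉

-- This is where the intervals starting at 0 matter: a violation can only come from too many
-- vertices, so it persists when other vertices are added.
∉-upward : ∀ I {m n} → n ∉ ⟦ I ⟧ → bound I < m → m ∉ ⟦ I ⟧
∉-upward [0,∞[   n∉ _   = λ _ → n∉ tt
∉-upward [0, k ] _  k<m = ℕ.<⇒≱ k<m

_∈𝔍₀?_ : ∀ n I → Dec (n ∈ ⟦ I ⟧)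
n ∈𝔍₀? [0,∞[   = yes tt
n ∈𝔍₀? [0, k ] = n ℕ.≤? k

module _ {d r} (τ : TypeEnumeration d r) (ρ : ZeroProfile τ) where

  violated : ∀ G → G ∈ 𝒞 d → G ∉ 𝒫 τ ρ → ∃ λ j → histogram τ G j ∉ ⟦ ρ j ⟧
  violated G G∈𝒞 G∉𝒫 = ¬∀⟶∃¬ _ _ (λ j → histogram τ G j ∈𝔍₀? ρ j) (G∉𝒫 ∘ (G∈𝒞 ,_))

  𝒫? : ∀ G → G ∈ 𝒞 d → Dec (G ∈ 𝒫 τ ρ)
  𝒫? G G∈𝒞 = yes G∈𝒞 ×-dec all? λ j → histogram τ G j ∈𝔍₀? ρ j

  maxBound : ℕ
  maxBound = proj₁ (≤-supremum (bound ∘ ρ))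

  -- At most `maxBound + 1` balls of at most `(1 + d) ^ r` vertices each, uniformly in the graph and
  -- the violated type.
  witnessSize : ℕ
  witnessSize = suc maxBound * suc d ^ r

  module Violation {G : Graph} (G∈𝒞 : G ∈ 𝒞 d) (j : Fin (#types τ)) (j-violated : histogram τ G j ∉ ⟦ ρ j ⟧) where

    j? : Decidable (λ v → 𝒩 r G v ≅ type τ j)
    j? v = 𝒩 r G v ≅? type τ j

    enough : suc (bound (ρ j)) ≤ length (elements j?)
    enough = ∉⇒bound< (ρ j) j-violated

    chosen : Fin (suc (bound (ρ j))) → V G
    chosen a = lookup (elements j?) (inject≤ a enough)

    chosen-injective : Injective _≡_ _≡_ chosen
    chosen-injective = inject≤-injective enough enough _ _ ∘ Filtered.injective j?

    chosen-type : ∀ a → 𝒩 r G (chosen a) ≅ type τ j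
    chosen-type a = satisfies j? (inject≤ a enough)

    reach : V G → List (V G)
    reach v = Bound.reach G G∈𝒞 v r

    region : List (V G)
    region = concatMap reach (tabulate chosen)

    ball⊆region : ∀ a {w} → N G r (chosen a) w → w ∈ₗ region
    ball⊆region a p = ∈-concatMap reach (∈-tabulate⁺ {f = chosen} a) (Bound.reach-complete G G∈𝒞 (chosen a) p)

    length-region≤ : length region ≤ witnessSize
    length-region≤ = begin
      length region                          ≤⟨ length-concatMap≤ reach (λ v → Bound.length-reach G G∈𝒞 v r) (tabulate chosen) ⟩
      length (tabulate chosen) * suc d ^ r   ≡⟨ cong (_* suc d ^ r) (length-tabulate chosen) ⟩
      suc (bound (ρ j)) * suc d ^ r          ≤⟨ ℕ.*-monoˡ-≤ (suc d ^ r) (s≤s (proj₂ (≤-supremum (bound ∘ ρ)) j)) ⟩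
      witnessSize                            ∎
      where open ℕ.≤-Reasoning

    module _ (S : List (V G)) (region⊆S : ∀ {w} → w ∈ₗ region → w ∈ₗ S) where
      open Excerpt G S

      -- The images of the chosen vertices are distinct and keep their type, so `H` exceeds the
      -- bound as well. `S` may be larger than `region` because one excerpt has to refute all
      -- profiles at once.
      embedding⇒∉𝒫 : ∀ H → ∃ (IsEmbedding excerpt H) → H ∉ 𝒫 τ ρ
      embedding⇒∉𝒫 H (f , emb) (_ , H∈) =
        ∉-upward (ρ j) j-violated
          (Filtered.injective⇒≤count (λ v → 𝒩 r H v ≅? type τ j) (f ∘ index) f∘index-injective copy-type)
          (H∈ j)
        where
        chosen∈S : ∀ a → chosen a ∈ₗ S
        chosen∈S a = region⊆S (ball⊆region a stop)

        index : Fin (suc (bound (ρ j))) → V (underlying excerpt)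
        index a = position ∈S? (chosen∈S a)

        ι∘index : ∀ a → ι (index a) ≡ chosen a
        ι∘index a = lookup-position ∈S? (chosen∈S a)

        f∘index-injective : Injective _≡_ _≡_ (f ∘ index)
        f∘index-injective {a} {b} eq = chosen-injective
          (trans (sym (ι∘index a)) (trans (cong ι (proj₁ emb eq)) (ι∘index b)))

        copy-type : ∀ a → 𝒩 r H (f (index a)) ≅ type τ j
        copy-type a = ≅-trans
          (≅-sym (type-preserved H f emb (index a)
            (λ {w} p → region⊆S (ball⊆region a (subst (λ v → N G r v w) (ι∘index a) p)))))
          (subst (λ v → 𝒩 r G v ≅ type τ j) (sym (ι∘index a)) (chosen-type a))

theorem3p4 : (d : ℕ) (τ : ∀ r → TypeEnumeration d r)
    (k : ℕ) (r : Fin k → ℕ) (ρ : ∀ i → ZeroProfile (τ (r i))) →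
    GSFLocal d (⋃ (Fin k) (λ i → 𝒫 (τ (r i)) (ρ i)))
-- The same family is used for every `n`.
theorem3p4 d τ k r ρ = (λ _ → 𝓕) , s , λ n →
  (λ F → proj₁) ,
  (λ { (G∈P@(_ , G∈𝒞 , _) , order≡) → G∈𝒞 , order≡ , λ F F∈𝓕 F↪G → proj₂ F∈𝓕 _ F↪G G∈P }) ,
  λ { (G∈𝒞 , order≡ , free) → free⇒∈P G∈𝒞 free , order≡ }
  where
  P : Pred Graph 0ℓ
  P = ⋃ (Fin k) (λ i → 𝒫 (τ (r i)) (ρ i))

  sizes : Fin k → ℕ
  sizes i = witnessSize (τ (r i)) (ρ i)

  s : ℕ
  s = k * proj₁ (≤-supremum sizes)

  𝓕 : Pred MarkedGraph 0ℓ
  𝓕 F = order (underlying F) ≤ s × (∀ H → ∃ (IsEmbedding F H) → H ∉ P)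

  Violated : Graph → Set
  Violated G = ∀ i → ∃ λ j → histogram (τ (r i)) G j ∉ ⟦ ρ i j ⟧

  module Obstruction (G : Graph) (G∈𝒞 : G ∈ 𝒞 d) (violation : Violated G) where

    module W i = Violation (τ (r i)) (ρ i) {G} G∈𝒞 (proj₁ (violation i)) (proj₂ (violation i))

    S : List (V G)
    -- For `k = 0` this is empty, and the empty excerpt embeds into every graph, matching the empty
    -- union.
    S = concatMap W.region (allFin k)

    open Excerpt G S public

    length-S≤ : length S ≤ s
    length-S≤ = ℕ.≤-trans
      (length-concatMap≤ W.region (λ i → ℕ.≤-trans (W.length-region≤ i) (proj₂ (≤-supremum sizes) i)) (allFin k))
      (ℕ.≤-reflexive (cong (_* proj₁ (≤-supremum sizes)) (length-tabulate {n = k} (λ i → i))))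

    excerpt∈𝓕 : excerpt ∈ 𝓕
    excerpt∈𝓕 = ℕ.≤-trans order≤ length-S≤ , λ { H F↪H (i , H∈𝒫) →
      W.embedding⇒∉𝒫 i S (∈-concatMap W.region (∈-allFin i)) H F↪H H∈𝒫 }

  -- Membership in `P` is decidable under the degree bound, so arguing by contradiction is
  -- constructive: if `G` were outside `P`, its own excerpt would be a forbidden graph embedded in
  -- it.
  free⇒∈P : ∀ {G} → G ∈ 𝒞 d → Free 𝓕 G → G ∈ P
  free⇒∈P {G} G∈𝒞 free = decidable-stable (any? λ i → 𝒫? (τ (r i)) (ρ i) G G∈𝒞) λ G∉P →
    let open Obstruction G G∈𝒞 (λ i → violated (τ (r i)) (ρ i) G G∈𝒞 (λ G∈𝒫 → G∉P (i , G∈𝒫)))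
    in free excerpt excerpt∈𝓕 (ι , ι-isEmbedding)
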